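{- For every finite simple connected graph $G$ of order $n$ (that is, $|V(G)|=n$) that is not Eulerian, $$\beta_S^n(G)=\eta(G).$$
   Context: For a finite simple graph $G$ and $v\in V(G)$, let $E_G(v)$ denote the set of all edges of $G$ incident with $v$. For a function $f:E(G)\to\{ -1,1\}$ and $S\subseteq E(G)$, write $f(S)=\sum_{e\in S}f(e)$. A signed $k$-submatching of $G$ is a function $f:E(G)\to\{ -1,1\}$ such that $f(E_G(v))\leq 1$ holds for at least $k$ vertices $v\in V(G)$. The signed $k$-submatching number $\beta_S^k(G)$ is the maximum of $f(E(G))$ taken over all signed $k$-submatchings $f$ of $G$. In particular, for $G$ of order $n$, $\beta_S^n(G)$ is the maximum of $f(E(G))$ over all $f:E(G)\to\{ -1,1\}$ with $f(E_G(v))\le 1$ for every vertex $v$. A trail is a walk with no repeated edge (vertices may repeat). A connected graph is Eulerian if it has a closed trail containing all its edges; equivalently, all its vertices have even degree. A vertex is called odd if its degree is odd. Let $G$ be a connected non-Eulerian graph, and let $2k$ (with $k\ge 1$) be the number of its odd vertices. A complete partition of $G$ is a partition $P$ of the edge set $E(G)$ into exactly $k$ trails $T_1,\ldots,T_k$, i.e. every edge of $G$ lies in exactly one $T_i$. (It is a standard fact that at least one complete partition exists.) For a complete partition $P:T_1,\ldots,T_k$, define $\tau(P)=|\{i : |E(T_i)| \text{ is odd}\}|$, the number of trails in $P$ having an odd number of edges. Define $\eta(G)=\max_P \tau(P)$, where the maximum is taken over all complete partitions $P$ of $G$. -}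

module Defs where

open import Algebra.Properties.CommutativeMonoid.Sum using (sum)
open import Data.Bool using (if_then_else_)
open import Data.Fin using (Fin; _<_)
open import Data.Fin.Properties using (_≟_)
open import Data.Fin.Subset using (Subset; ∣_∣; ⊤)
open import Data.Integer as ℤ using (ℤ; 0ℤ; 1ℤ; _◃_)
open import Data.Integer.Properties as ℤ using (+-0-commutativeMonoid)
open import Data.List using (List; []; _∷_; length)
open import Data.List.Membership.Propositional using (_∈_)
open import Data.List.Relation.Unary.Unique.Propositional using (Unique)
open import Data.Nat as ℕ using (ℕ; _*_; parity)
open import Data.Parity using (1ℙ)
import Data.Parity.Properties as ℙ
open import Data.Product using (∃-syntax; ∃!; _×_)
open import Data.Sign using (Sign)
open import Data.Sum using (_⊎_)
open import Data.Vec using (tabulate; lookup)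
open import Level using (Level)
open import Relation.Binary using (Rel)
open import Relation.Binary.PropositionalEquality using (_≡_)
open import Relation.Nullary using (Dec; does)
open import Relation.Nullary.Decidable using (_⊎-dec_)
open import Relation.Unary using (Pred; Decidable)

private
  variable
    ℓ : Level
    n : ℕ

subset : {P : Pred (Fin n) ℓ} → Decidable P → Subset n
subset P? = tabulate (λ i → does (P? i))

IsMaximum : {A B : Set} → Rel B ℓ → (A → B) → B → Set ℓ
IsMaximum _≤_ g m = (∃[ a ] g a ≡ m) × (∀ a → g a ≤ m)

Odd : ℕ → Set
Odd m = parity m ≡ 1ℙ

odd? : Decidable Odd
odd? m = parity m ℙ.≟ 1ℙ

-- A finite simple graph with vertex set Fin n and edge set Fin size.  Each
-- edge is an unordered pair of distinct vertices, stored with the smaller one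
-- as src, and no two edges have the same pair of endpoints.
record Graph (n : ℕ) : Set where
  field
    size     : ℕ
    src tgt  : Fin size → Fin n
    src<tgt  : ∀ e → src e < tgt e
    simple   : ∀ e e′ → src e ≡ src e′ → tgt e ≡ tgt e′ → e ≡ e′

module _ (G : Graph n) where
  open Graph G

  Vertex : Set
  Vertex = Fin n

  Edge : Set
  Edge = Fin size

  Incident : Vertex → Edge → Set
  Incident v e = src e ≡ v ⊎ tgt e ≡ v

  incident? : ∀ v → Decidable (Incident v)
  incident? v e = (src e ≟ v) ⊎-dec (tgt e ≟ v)

  incidentEdges : Vertex → Subset size
  incidentEdges v = subset (incident? v)

  degree : Vertex → ℕ
  degree v = ∣ incidentEdges v ∣

  oddVertices : Subset n
  oddVertices = subset (λ v → odd? (degree v))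

  Joins : Edge → Vertex → Vertex → Set
  Joins e u v = (src e ≡ u × tgt e ≡ v) ⊎ (src e ≡ v × tgt e ≡ u)

  data Walk : Vertex → Vertex → Set where
    nil  : ∀ {v} → Walk v v
    cons : ∀ {u v w} (e : Edge) → Joins e u v → Walk v w → Walk u w

  walkEdges : ∀ {u v} → Walk u v → List Edge
  walkEdges nil          = []
  walkEdges (cons e _ p) = e ∷ walkEdges p

  IsTrail : ∀ {u v} → Walk u v → Set
  IsTrail p = Unique (walkEdges p)

  record Trail : Set where
    field
      {start end} : Vertex
      walk        : Walk start end
      isTrail     : IsTrail walk

    edges : List Edge
    edges = walkEdges walk

  -- The graph without vertices is not connected.
  Connected : Set
  Connected = Vertex × (∀ u v → Walk u v)

  Eulerian : Set
  Eulerian = ∃[ v ] ∃[ p ] IsTrail {v} {v} p × (∀ e → e ∈ walkEdges p)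

  Signing : Set
  Signing = Edge → Sign

  weight : Signing → Subset size → ℤ
  weight f S = sum +-0-commutativeMonoid
    (λ e → if lookup S e then f e ◃ 1 else 0ℤ)

  satisfiedVertices : Signing → Subset n
  satisfiedVertices f = subset (λ v → weight f (incidentEdges v) ℤ.≤? 1ℤ)

  record SignedSubmatching (k : ℕ) : Set where
    field
      signing   : Signing
      satisfied : k ℕ.≤ ∣ satisfiedVertices signing ∣

    totalWeight : ℤ
    totalWeight = weight signing ⊤

  -- β_S^k(G) = b
  IsSignedSubmatchingNumber : ℕ → ℤ → Set
  IsSignedSubmatchingNumber k b =
    IsMaximum ℤ._≤_ (SignedSubmatching.totalWeight {k}) b

  -- Edgeless trails need not be excluded: the 2k odd vertices must all be ends
  -- of the k trails, so no trail is closed.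
  record CompletePartition : Set where
    field
      k         : ℕ
      2k-odd    : 2 * k ≡ ∣ oddVertices ∣
      trails    : Fin k → Trail
      partition : ∀ e → ∃! _≡_ (λ i → e ∈ Trail.edges (trails i))

    τ : ℕ
    τ = ∣ subset (λ i → odd? (length (Trail.edges (trails i)))) ∣

  -- η(G) = h
  IsEta : ℕ → Set
  IsEta h = IsMaximum ℕ._≤_ CompletePartition.τ h

{-# OPTIONS --safe #-}
module Submission where

-- Alternating the signs along every trail of a complete partition, starting
-- with +, gives a signing of total weight τ: inner visits of trails to a vertex
-- cancel, and each vertex is an end of at most one trail, because the 2k odd
-- vertices use up all 2k trail ends.
--
-- Conversely, let a signing have f(E(v)) ≤ 1 at every vertex.  Start from all
-- single edges as trails, each end carrying the sign of the edge, and as long as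
-- two ends meet at a vertex, glue a − end to another end there (to a + end if
-- there is one).  Every open trail T with end signs s, t satisfies
-- 2 f(T) ≤ s + t, and every trail that closes up has weight ≤ 0.  In the end each
-- odd vertex carries one end and each even vertex none, so k open trails
-- remain, each of weight ≤ 1.  By connectedness the closed trails can be spliced
-- into the open ones without raising weights, and a trail of weight ≤ 1 has
-- weight ≤ 0 if its length is even, so the total weight is at most τ.  If no open
-- trail is left, splicing into an empty trail gives an Eulerian trail instead.

open import Defs
open import Algebra.Bundles using (CommutativeMonoid)
import Algebra.Properties.CommutativeMonoid.Sum as FinSum
import Algebra.Properties.CommutativeSemigroup as CommSemigroup
open import Data.Bool using (true; false; if_then_else_)
open import Data.Fin using (Fin; zero; suc)
open import Data.Fin.Properties as Fin using (_≟_)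
open import Data.Fin.Subset using (∣_∣; ⊤)
open import Data.Fin.Subset.Properties using (∣p∣≤n; ∣p∣≡n⇒p≡⊤)
open import Data.Integer as ℤ using (ℤ; +_; 0ℤ; 1ℤ; -1ℤ; _◃_; +≤+; -≤+; -[1+_])
import Data.Integer.Properties as ℤ
open import Data.List
  using (List; []; _∷_; _++_; allFin; cartesianProductWith; concat; concatMap; filter; length;
         lookup; map; tabulate)
open import Data.List.Extrema ℤ.≤-totalOrder using (argmax; argmax-all; f[xs]≤f[argmax])
import Data.List.Membership.DecPropositional as DecMembership
open import Data.List.Membership.Propositional using (_∈_; _∉_)
open import Data.List.Membership.Propositional.Properties
  using (∈-∃++; ∈-++⁺ˡ; ∈-++⁺ʳ; ∈-++⁻; ∈-allFin; ∈-cartesianProductWith⁺; ∈-concat⁺′;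
         ∈-concatMap⁻; ∈-filter⁺; ∈-tabulate⁺)
open import Data.List.Membership.Propositional.Properties.WithK
  using (unique⇒irrelevant; unique∧set⇒bag)
open import Data.List.Properties using (length-map; map-tabulate)
open import Data.List.Relation.Binary.BagAndSetEquality using (∼bag⇒↭)
open import Data.List.Relation.Binary.Disjoint.Propositional using (Disjoint)
open import Data.List.Relation.Binary.Permutation.Propositional as ↭
  using (_↭_; prep; ↭-refl; ↭-reflexive; ↭-sym; ↭-trans; ↭⇒↭ₛ; module PermutationReasoning)
open import Data.List.Relation.Binary.Permutation.Propositional.Properties
  using (++-assoc; ++-comm; ++-identityʳ; ++⁺ʳ; ++⁺ˡ; drop-∷; shift; shifts; ↭-length; ∈-resp-↭)
import Data.List.Relation.Binary.Permutation.Setoid.Properties as Permutationₛ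
open import Data.List.Relation.Unary.All as All using (All; []; _∷_)
import Data.List.Relation.Unary.All.Properties as All
open import Data.List.Relation.Unary.AllPairs using ([]; _∷_)
import Data.List.Relation.Unary.AllPairs.Properties as AllPairs
open import Data.List.Relation.Unary.Any as Any using (Any; here; there)
open import Data.List.Relation.Unary.Any.Properties using (lookup-index)
open import Data.List.Relation.Unary.Unique.Propositional using (Unique)
import Data.List.Relation.Unary.Unique.Propositional.Properties as Unique
open import Data.Nat as ℕ using (ℕ; zero; suc; z≤n; s≤s; parity)
import Data.Nat.Properties as ℕ
open import Data.Parity as ℙ using (0ℙ; 1ℙ; _⁻¹)
import Data.Parity.Properties as ℙ
open import Data.Product using (∃; ∃₂; ∃-syntax; Σ-syntax; _×_; _,_; proj₁; proj₂)
open import Data.Product.Properties using (≡-dec)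
open import Data.Sign as Sign using (Sign)
import Data.Sign.Properties as Sign
open import Data.Sum using (inj₁; inj₂)
open import Data.Vec as Vec using (Vec)
open import Data.Vec.Properties using (lookup∘tabulate; lookup-replicate)
open import Function using (_∘_; id; mk⇔)
open import Level using (0ℓ)
open import Relation.Binary.PropositionalEquality as ≡
  using (_≡_; _≢_; refl; sym; trans; cong; cong₂; subst; module ≡-Reasoning)
open import Relation.Nullary using (¬_; yes; no; does; contradiction)
open import Relation.Nullary.Decidable using (dec-true; dec-false)
open import Relation.Unary using (Pred; Decidable)

-- Sums over lists and over the edges at a vertex.

module Sums (M : CommutativeMonoid 0ℓ 0ℓ) where
  open CommutativeMonoid M renaming (refl to ≈-refl; sym to ≈-sym; trans to ≈-trans)
  open FinSum M using (sum; sum-cong-≋)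
  open import Relation.Binary.Reasoning.Setoid setoid
  open import Algebra.Properties.CommutativeSemigroup commutativeSemigroup
    using (x∙yz≈y∙xz)

  private
    variable
      A B : Set

  total : (A → Carrier) → List A → Carrier
  total g []       = ε
  total g (x ∷ xs) = g x ∙ total g xs

  total-++ : ∀ (g : A → Carrier) xs ys → total g (xs ++ ys) ≈ total g xs ∙ total g ys
  total-++ g []       ys = ≈-sym (identityˡ _)
  total-++ g (x ∷ xs) ys = ≈-trans (∙-congˡ (total-++ g xs ys)) (≈-sym (assoc _ _ _))

  total-concatMap : ∀ (g : B → Carrier) (h : A → List B) xs →
    total g (concatMap h xs) ≈ total (total g ∘ h) xs
  total-concatMap g h []       = ≈-refl
  total-concatMap g h (x ∷ xs) =
    ≈-trans (total-++ g (h x) (concatMap h xs)) (∙-congˡ (total-concatMap g h xs))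

  total-↭ : ∀ (g : A → Carrier) {xs ys} → xs ↭ ys → total g xs ≈ total g ys
  total-↭ g ↭.refl       = ≈-refl
  total-↭ g (prep x p)   = ∙-congˡ (total-↭ g p)
  total-↭ g (↭.swap x y p) = ≈-trans (x∙yz≈y∙xz _ _ _) (∙-congˡ (∙-congˡ (total-↭ g p)))
  total-↭ g (↭.trans p q)  = ≈-trans (total-↭ g p) (total-↭ g q)

  total-tabulate : ∀ {n} (g : A → Carrier) (h : Fin n → A) → total g (tabulate h) ≡ sum (g ∘ h)
  total-tabulate {n = zero}  g h = refl
  total-tabulate {n = suc n} g h = cong (g (h zero) ∙_) (total-tabulate g (h ∘ suc))

  total-lookup : ∀ (g : A → Carrier) xs → sum (g ∘ lookup xs) ≡ total g xs
  total-lookup g []       = refl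
  total-lookup g (x ∷ xs) = cong (g x ∙_) (total-lookup g xs)

  -- The Kronecker delta of `u` and `v`, scaled by `m`.
  at : ∀ {n} → Fin n → Fin n → Carrier → Carrier
  at v u m = if does (u ≟ v) then m else ε

  at-≡ : ∀ {n} (v : Fin n) m → at v v m ≡ m
  at-≡ v m = cong (if_then m else ε) (dec-true (v ≟ v) refl)

  at-≢ : ∀ {n} {u v : Fin n} m → u ≢ v → at v u m ≡ ε
  at-≢ {u = u} {v} m u≢v = cong (if_then m else ε) (dec-false (u ≟ v) u≢v)

  module _ {n} (G : Graph n) where
    open Graph G

    -- The share of an edge in a sum over the star of `v`, written end by end. In this form star
    -- sums can be regrouped along walks and over lists of trail ends.
    halves : Vertex G → (Edge G → Carrier) → Edge G → Carrier
    halves v m e = at v (src e) (m e) ∙ at v (tgt e) (m e)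

    halves-joins : ∀ v m {e u w} → Joins G e u w → halves v m e ≈ at v u (m e) ∙ at v w (m e)
    halves-joins v m (inj₁ (refl , refl)) = ≈-refl
    halves-joins v m (inj₂ (refl , refl)) = comm _ _

    incident-halves : ∀ v m e → (if does (incident? G v e) then m e else ε) ≈ halves v m e
    incident-halves v m e with src e ≟ v | tgt e ≟ v
    -- Both ends at `v` would make `e` a loop, so no edge is counted twice.
    ... | yes p | yes q = contradiction (trans p (sym q)) (Fin.<⇒≢ (src<tgt e))
    ... | yes p | no ¬q = ≈-sym (identityʳ _)
    ... | no ¬p | yes q = ≈-sym (identityˡ _)
    ... | no ¬p | no ¬q = ≈-sym (identityˡ _)

    star : ∀ v m → sum (λ e → if does (incident? G v e) then m e else ε)
                   ≈ total (halves v m) (allFin size)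
    star v m = begin
      sum (λ e → if does (incident? G v e) then m e else ε) ≈⟨ sum-cong-≋ (incident-halves v m) ⟩
      sum (halves v m)                                      ≡⟨ total-tabulate (halves v m) id ⟨
      total (halves v m) (allFin size)                      ∎

module Σℕ = Sums ℕ.+-0-commutativeMonoid
module Σℤ = Sums ℤ.+-0-commutativeMonoid

module ℕΣ = FinSum ℕ.+-0-commutativeMonoid
module ℤΣ = FinSum ℤ.+-0-commutativeMonoid

open ℕΣ using () renaming (sum to sumℕ)
open ℤΣ using () renaming (sum to sumℤ)

∣subset∣ : ∀ {n ℓ} {P : Pred (Fin n) ℓ} (P? : Decidable P) →
  ∣ subset P? ∣ ≡ sumℕ (λ i → if does (P? i) then 1 else 0)
∣subset∣ {zero}  P? = refl
∣subset∣ {suc n} P? with does (P? zero)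
... | true  = cong suc (∣subset∣ (P? ∘ suc))
... | false = ∣subset∣ (P? ∘ suc)

∈⇒↭ : ∀ {A : Set} {x : A} {xs} → x ∈ xs → ∃[ ys ] xs ↭ x ∷ ys
∈⇒↭ x∈xs with ys , zs , refl ← ∈-∃++ x∈xs = ys ++ zs , shift _ ys zs

-- Signed ends and their cancellation in pairs.

value : Sign → ℤ
value s = s ◃ 1

-- The end of a trail: its vertex, with the sign of its first or last edge.
End : ℕ → Set
End n = Fin n × Sign

module _ {n : ℕ} where

  open DecMembership (≡-dec (Fin._≟_ {n}) Sign._≟_) using (_∈?_)

  -- For the ends of all single edges, `count v` is the degree of `v` and `charge v` is f(E(v)).
  count : Fin n → List (End n) → ℕ
  count v = Σℕ.total (λ x → Σℕ.at v (proj₁ x) 1)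

  charge : Fin n → List (End n) → ℤ
  charge v = Σℤ.total (λ x → Σℤ.at v (proj₁ x) (value (proj₂ x)))

  no-minus : ∀ v L → (v , Sign.-) ∉ L → charge v L ≡ + count v L
  no-minus v []            ∉L = refl
  no-minus v ((u , s) ∷ L) ∉L with u ≟ v | s
  ... | no  _    | _      = trans (ℤ.+-identityˡ _) (no-minus v L (∉L ∘ there))
  ... | yes refl | Sign.- = contradiction (here refl) ∉L
  ... | yes refl | Sign.+ = cong (ℤ._+_ 1ℤ) (no-minus v L (∉L ∘ there))

  no-plus : ∀ v L → (v , Sign.+) ∉ L → charge v L ℤ.≤ 0ℤ
  no-plus v []            ∉L = ℤ.≤-refl
  no-plus v ((u , s) ∷ L) ∉L with u ≟ v | s
  ... | no  _    | _      = ℤ.+-mono-≤ {0ℤ} ℤ.≤-refl (no-plus v L (∉L ∘ there))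
  ... | yes refl | Sign.+ = contradiction (here refl) ∉L
  ... | yes refl | Sign.- = ℤ.+-mono-≤ { -1ℤ} {0ℤ} -≤+ (no-plus v L (∉L ∘ there))

  charge-plus-minus : ∀ w v L → charge w ((v , Sign.-) ∷ (v , Sign.+) ∷ L) ≡ charge w L
  charge-plus-minus w v L with does (v ≟ w)
  ... | true  = trans (sym (ℤ.+-assoc -1ℤ 1ℤ (charge w L))) (ℤ.+-identityˡ _)
  ... | false = trans (ℤ.+-identityˡ _) (ℤ.+-identityˡ _)

  Admissible : List (End n) → Set
  Admissible L = ∀ v → charge v L ℤ.≤ 1ℤ

  -- A `+` partner leaves every charge unchanged. A second `-` is taken only when no `+` end lies at
  -- `v`, and then the charge there cannot become positive.
  cancel-pair : ∀ {L} v → Admissible L → 1 ℕ.< count v L →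
    ∃[ s ] ∃[ L′ ] L ↭ (v , Sign.-) ∷ (v , s) ∷ L′ × Admissible L′
  cancel-pair {L} v adm 1<c with (v , Sign.-) ∈? L
  -- With only `+` ends at `v` the charge would equal the count, which exceeds 1.
  ... | no ∉L = contradiction (subst (ℤ._≤ 1ℤ) (no-minus v L ∉L) (adm v))
                              (λ { (+≤+ c≤1) → ℕ.<⇒≱ 1<c c≤1 })
  ... | yes -∈L with ∈⇒↭ -∈L
  ...   | L₁ , p with (v , Sign.+) ∈? L₁
  ...     | yes +∈L₁ with L₂ , q ← ∈⇒↭ +∈L₁ =
    Sign.+ , L₂ , p′ , λ w → subst (ℤ._≤ 1ℤ)
      (trans (Σℤ.total-↭ _ p′) (charge-plus-minus w v L₂)) (adm w)
    where p′ = ↭-trans p (prep _ q)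
  ...     | no +∉L₁ with (v , Sign.-) ∈? L₁
  -- With neither sign left at `v`, the first `-` end was the only end there.
  ...       | no -∉L₁ = contradiction 1<c (ℕ.≤⇒≯ c≤1)
    where
    charge≤0 : + count v L₁ ℤ.≤ 0ℤ
    charge≤0 = subst (ℤ._≤ 0ℤ) (no-minus v L₁ -∉L₁) (no-plus v L₁ +∉L₁)
    c≤1 : count v L ℕ.≤ 1
    c≤1 = begin
      count v L                       ≡⟨ Σℕ.total-↭ _ p ⟩
      Σℕ.at v v 1 ℕ.+ count v L₁
        ≡⟨ cong₂ ℕ._+_ (Σℕ.at-≡ v 1) (ℕ.n≤0⇒n≡0 (ℤ.drop‿+≤+ charge≤0)) ⟩
      1                               ∎
      where open ℕ.≤-Reasoning
  ...       | yes -∈L₁ with L₂ , q ← ∈⇒↭ -∈L₁ =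
    Sign.- , L₂ , p′ , λ w → adm′ w (v ≟ w)
    where
    p′ = ↭-trans p (prep _ q)
    adm′ : ∀ w → _ → charge w L₂ ℤ.≤ 1ℤ
    -- Removing two `-` ends raises the charge at `v` by 2, but without `+` ends it stays at most 0.
    adm′ w (yes refl) = ℤ.≤-trans (no-plus v L₂ (+∉L₁ ∘ ∈-resp-↭ (↭-sym q) ∘ there)) (+≤+ z≤n)
    adm′ w (no v≢w)   = subst (ℤ._≤ 1ℤ) eq (adm w)
      where
      open ≡-Reasoning
      eq : charge w L ≡ charge w L₂
      eq = begin
        charge w L ≡⟨ Σℤ.total-↭ _ p′ ⟩
        Σℤ.at w v -1ℤ ℤ.+ (Σℤ.at w v -1ℤ ℤ.+ charge w L₂)
          ≡⟨ cong₂ (λ i j → i ℤ.+ (j ℤ.+ charge w L₂)) (Σℤ.at-≢ -1ℤ v≢w) (Σℤ.at-≢ -1ℤ v≢w) ⟩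
        0ℤ ℤ.+ (0ℤ ℤ.+ charge w L₂) ≡⟨ trans (ℤ.+-identityˡ _) (ℤ.+-identityˡ _) ⟩
        charge w L₂ ∎

  Settled : List (End n) → Set
  Settled L = ∀ v → count v L ℕ.≤ 1

  -- A gluing plan recorded on end lists alone, so that the choice of pairs and termination are
  -- dealt with before any walk is handled.
  data Reduces : List (End n) → Set where
    settled : ∀ {L} → Settled L → Reduces L
    cancel  : ∀ {L v s L′} → L ↭ (v , Sign.-) ∷ (v , s) ∷ L′ → Reduces L′ → Reduces L

  -- `k` is fuel: each cancellation shortens the list by two, so one unit per step suffices.
  reduces : ∀ k {L} → length L ℕ.< k → Admissible L → Reduces L
  reduces (suc k) {L} (s≤s len≤k) adm with Fin.all? (λ v → count v L ℕ.≤? 1)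
  ... | yes set = settled set
  ... | no ¬set
    with v , ¬c≤1 ← Fin.¬∀⟶∃¬ n _ (λ v → count v L ℕ.≤? 1) ¬set
    with s , L′ , p , adm′ ← cancel-pair v adm (ℕ.≰⇒> ¬c≤1) =
    cancel p (reduces k (ℕ.≤-trans (ℕ.n≤1+n _) (subst (ℕ._≤ k) (↭-length p) len≤k)) adm′)

-- Integer bounds for doubled weights.

twice≤0 : ∀ i → i ℤ.+ i ℤ.≤ 0ℤ → i ℤ.≤ 0ℤ
twice≤0 (+ zero)   _        = ℤ.≤-refl
twice≤0 (+ suc _)  (+≤+ ())
twice≤0 -[1+ _ ]   _        = -≤+

twice≤2 : ∀ i → i ℤ.+ i ℤ.≤ + 2 → i ℤ.≤ 1ℤ
twice≤2 (+ zero)        _ = +≤+ z≤n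
twice≤2 (+ suc zero)    _ = ℤ.≤-refl
twice≤2 (+ suc (suc m)) (+≤+ (s≤s (s≤s le))) = 
  contradiction (ℕ.m+n≡0⇒n≡0 m (ℕ.n≤0⇒n≡0 le)) (λ ())
twice≤2 -[1+ _ ]        _ = -≤+

value≤1 : ∀ s → value s ℤ.≤ 1ℤ
value≤1 Sign.+ = ℤ.≤-refl
value≤1 Sign.- = -≤+

open CommSemigroup ℤ.+-commutativeSemigroup using () renaming (interchange to +-interchange)

-- The glued ends contribute `-1 + value s`, at most 0 for either sign, so only the outer ends
-- remain in the bound.
join-bound : ∀ {i j a b c} s → i ℤ.+ i ℤ.≤ -1ℤ ℤ.+ a → j ℤ.+ j ℤ.≤ value s ℤ.+ b → c ≡ i ℤ.+ j →
  c ℤ.+ c ℤ.≤ a ℤ.+ b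
join-bound {i} {j} {a} {b} s p q refl = begin
  (i ℤ.+ j) ℤ.+ (i ℤ.+ j)             ≡⟨ +-interchange i j i j ⟩
  (i ℤ.+ i) ℤ.+ (j ℤ.+ j)             ≤⟨ ℤ.+-mono-≤ p q ⟩
  (-1ℤ ℤ.+ a) ℤ.+ (value s ℤ.+ b)     ≡⟨ +-interchange -1ℤ a (value s) b ⟩
  (-1ℤ ℤ.+ value s) ℤ.+ (a ℤ.+ b)     ≤⟨ ℤ.+-monoˡ-≤ (a ℤ.+ b) (ℤ.+-monoʳ-≤ -1ℤ (value≤1 s)) ⟩
  0ℤ ℤ.+ (a ℤ.+ b)                    ≡⟨ ℤ.+-identityˡ _ ⟩
  a ℤ.+ b                             ∎
  where open ℤ.≤-Reasoning

-- Concatenating, reversing and cutting walks.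

module _ {n} (G : Graph n) where
  open Graph G

  private
    variable
      u v w x y : Vertex G

  infixr 5 _⁀_
  _⁀_ : Walk G u v → Walk G v w → Walk G u w
  nil        ⁀ q = q
  cons e j p ⁀ q = cons e j (p ⁀ q)

  walkEdges-⁀ : ∀ (p : Walk G u v) (q : Walk G v w) →
    walkEdges G (p ⁀ q) ≡ walkEdges G p ++ walkEdges G q
  walkEdges-⁀ nil          q = refl
  walkEdges-⁀ (cons e j p) q = cong (e ∷_) (walkEdges-⁀ p q)

  Joins-sym : ∀ {e} → Joins G e u v → Joins G e v u
  Joins-sym (inj₁ j) = inj₂ j
  Joins-sym (inj₂ j) = inj₁ j

  reverse : Walk G u v → Walk G v u
  reverse nil          = nil
  reverse (cons e j p) = reverse p ⁀ cons e (Joins-sym j) nil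

  walkEdges-reverse : ∀ (p : Walk G u v) → walkEdges G (reverse p) ↭ walkEdges G p
  walkEdges-reverse nil          = ↭-refl
  walkEdges-reverse (cons e j p) = ↭-trans
    (↭-reflexive (walkEdges-⁀ (reverse p) _))
    (↭-trans (++-comm (walkEdges G (reverse p)) (e ∷ [])) (prep e (walkEdges-reverse p)))

  -- A visit of the walk to `x`, given as the two pieces that meet there, ready for splicing.
  Split : Walk G u w → Vertex G → Set
  Split {u} {w} p x = Σ[ a ∈ Walk G u x ] Σ[ b ∈ Walk G x w ]
    walkEdges G p ≡ walkEdges G a ++ walkEdges G b

  split-start : (p : Walk G u w) → Split p u
  split-start p = nil , p , refl

  split-incident : ∀ {e} (p : Walk G u w) → e ∈ walkEdges G p → Incident G x e → Split p x
  split-incident p@(cons e (inj₁ (refl , _)) q) (here refl) (inj₁ refl) = split-start p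
  split-incident p@(cons e (inj₂ (_ , refl)) q) (here refl) (inj₂ refl) = split-start p
  split-incident (cons e j@(inj₁ (_ , refl)) q) (here refl) (inj₂ refl) = cons e j nil , q , refl
  split-incident (cons e j@(inj₂ (refl , _)) q) (here refl) (inj₁ refl) = cons e j nil , q , refl
  split-incident (cons e j q) (there e∈q) inc with a , b , eq ← split-incident q e∈q inc =
    cons e j a , b , cong (e ∷_) eq

  Joins⇒Incidentˡ : ∀ {e} → Joins G e u v → Incident G u e
  Joins⇒Incidentˡ (inj₁ (p , _)) = inj₁ p
  Joins⇒Incidentˡ (inj₂ (_ , q)) = inj₂ q

  Joins⇒Incidentʳ : ∀ {e} → Joins G e u v → Incident G v e
  Joins⇒Incidentʳ = Joins⇒Incidentˡ ∘ Joins-sym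

  -- Gluing arcs along a cancellation of their ends.

  module _ (f : Signing G) where

    listWeight : List (Edge G) → ℤ
    listWeight = Σℤ.total (value ∘ f)

    walkWeight : Walk G u v → ℤ
    walkWeight p = listWeight (walkEdges G p)

    walkWeight-⁀ : ∀ (p : Walk G u v) (q : Walk G v w) →
      walkWeight (p ⁀ q) ≡ walkWeight p ℤ.+ walkWeight q
    walkWeight-⁀ p q = trans (cong listWeight (walkEdges-⁀ p q)) (Σℤ.total-++ _ (walkEdges G p) _)

    walkWeight-reverse : ∀ (p : Walk G u v) → walkWeight (reverse p) ≡ walkWeight p
    walkWeight-reverse p = Σℤ.total-↭ _ (walkEdges-reverse p)

    -- Doubling turns the bound (s + t) / 2 into an integer one; it is an equality
    -- for a single edge and survives gluing at two ends whose signs sum to ≤ 0.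
    record Arc (x y : End n) : Set where
      constructor arc
      field
        walk  : Walk G (proj₁ x) (proj₁ y)
        bound : walkWeight walk ℤ.+ walkWeight walk ℤ.≤ value (proj₂ x) ℤ.+ value (proj₂ y)

      arcEdges : List (Edge G)
      arcEdges = walkEdges G walk

    open Arc using (arcEdges)

    reverse-arc : ∀ {x y} → Arc x y → Arc y x
    reverse-arc {u , s} {w , t} (arc p le) = arc (reverse p) (begin
      walkWeight (reverse p) ℤ.+ walkWeight (reverse p)
        ≡⟨ cong (λ i → i ℤ.+ i) (walkWeight-reverse p) ⟩
      walkWeight p ℤ.+ walkWeight p                     ≤⟨ le ⟩
      value s ℤ.+ value t                               ≡⟨ ℤ.+-comm (value s) (value t) ⟩
      value t ℤ.+ value s                               ∎)
      where open ℤ.≤-Reasoning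

    join-arc : ∀ {v s x y} → Arc (v , Sign.-) x → Arc (v , s) y → Arc x y
    join-arc {s = s} {_ , t} {_ , t′} (arc p le) (arc q le′) =
      -- Both arcs start at the glued vertex, so the first is run backwards.
      arc (reverse p ⁀ q)
      (join-bound {i = walkWeight p} {j = walkWeight q} {a = value t} s le le′
        (trans (walkWeight-⁀ (reverse p) q) (cong (ℤ._+ walkWeight q) (walkWeight-reverse p))))

    join-arc-edges : ∀ {v s x y} (a : Arc (v , Sign.-) x) (b : Arc (v , s) y) →
      arcEdges (join-arc a b) ↭ arcEdges a ++ arcEdges b
    join-arc-edges (arc p _) (arc q _) = ↭-trans (↭-reflexive (walkEdges-⁀ (reverse p) q))
      (++⁺ʳ _ (walkEdges-reverse p))

    record Bounded (b : ℤ) (u w : Vertex G) : Set where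
      constructor bounded
      field
        walk  : Walk G u w
        bound : walkWeight walk ℤ.≤ b

      boundedEdges : List (Edge G)
      boundedEdges = walkEdges G walk

    open Bounded using (boundedEdges)

    Tour : Set
    Tour = ∃[ v ] Bounded 0ℤ v v

    tourEdges : Tour → List (Edge G)
    tourEdges (_ , c) = boundedEdges c

    -- The two end signs sum to at most 0, which bounds twice the weight and hence the weight.
    close-arc : ∀ {v s} → Arc (v , Sign.-) (v , s) → Tour
    close-arc {s = s} (arc p le) =
      _ , bounded p (twice≤0 _ (ℤ.≤-trans le (ℤ.+-monoʳ-≤ -1ℤ (value≤1 s))))

    arc⇒bounded : ∀ {x y} → Arc x y → Bounded 1ℤ (proj₁ x) (proj₁ y)
    arc⇒bounded {_ , s} {_ , t} (arc p le) =
      bounded p (twice≤2 _ (ℤ.≤-trans le (ℤ.+-mono-≤ (value≤1 s) (value≤1 t))))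

    Arcs : Set
    Arcs = List (∃₂ Arc)

    ends : Arcs → List (End n)
    ends = concatMap (λ (x , y , _) → x ∷ y ∷ [])

    arcsEdges : Arcs → List (Edge G)
    arcsEdges = concatMap (λ (_ , _ , a) → arcEdges a)

    toursEdges : List Tour → List (Edge G)
    toursEdges = concatMap tourEdges

    -- If `x` is the last end of its arc, the arc is reversed so that it can be read from `x`.
    ∈-ends⇒arc : ∀ {x} as → x ∈ ends as → ∃[ y ] Σ[ a ∈ Arc x y ] ∃[ bs ]
      ends as ↭ x ∷ y ∷ ends bs × arcsEdges as ↭ arcEdges a ++ arcsEdges bs
    ∈-ends⇒arc ((x , y , a) ∷ as) (here refl) = y , a , as , ↭-refl , ↭-refl
    ∈-ends⇒arc ((x , y , a) ∷ as) (there (here refl)) =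
      x , reverse-arc a , as , ↭.swap x y ↭-refl , ++⁺ʳ _ (↭-sym (walkEdges-reverse (Arc.walk a)))
    ∈-ends⇒arc {z} ((x , y , a) ∷ as) (there (there z∈as))
      with y′ , b , bs , p , q ← ∈-ends⇒arc as z∈as =
      y′ , b , (x , y , a) ∷ bs ,
      ↭-trans (++⁺ˡ (x ∷ y ∷ []) p) (shifts (x ∷ y ∷ []) (z ∷ y′ ∷ [])) ,
      ↭-trans (++⁺ˡ (arcEdges a) q) (shifts (arcEdges a) (arcEdges b))

    -- Both removed ends lie at one vertex, so the count drops by 2 there and by 0 elsewhere.
    parity-count : ∀ v {L} (x y : End n) L′ → proj₁ x ≡ proj₁ y → L ↭ x ∷ y ∷ L′ →
      parity (count v L) ≡ parity (count v L′)
    parity-count v (u , _) (_ , _) L′ refl p rewrite Σℕ.total-↭ (λ x → Σℕ.at v (proj₁ x) 1) p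
      with does (u ≟ v)
    ... | true  = refl
    ... | false = refl

    -- `parity≡` is the gluing invariant. Starting from single edges, it shows together with
    -- `isSettled` that exactly the odd vertices carry an end.
    record Assembly (as : Arcs) : Set where
      constructor assembly
      field
        arcs    : Arcs
        tours   : List Tour
        edges↭  : arcsEdges as ↭ arcsEdges arcs ++ toursEdges tours
        isSettled : Settled (ends arcs)
        parity≡ : ∀ v → parity (count v (ends as)) ≡ parity (count v (ends arcs))

    assemble : ∀ {L} → Reduces L → ∀ as → ends as ↭ L → Assembly as
    assemble (settled set) as p = assembly as [] (↭-sym (++-identityʳ _))
      (λ v → subst (ℕ._≤ 1) (sym (Σℕ.total-↭ _ p)) (set v)) (λ _ → refl)
    assemble (cancel {v = v} {s} {L′} r red) as p
      with ends↭ ← ↭-trans p r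
      with y , a , bs , q , es ← ∈-ends⇒arc as (∈-resp-↭ (↭-sym ends↭) (here refl))
      with drop-∷ (↭-trans (↭-sym ends↭) q)
    ... | q′ with ∈-resp-↭ q′ (here refl)
    -- The partner is the other end of the same arc, so gluing closes it to a tour.
    ...   | here refl
      with assembly arcs tours es′ set par ← assemble red bs (↭-sym (drop-∷ q′)) =
      assembly arcs (close-arc a ∷ tours)
        (↭-trans es (↭-trans (++⁺ˡ (arcEdges a) es′) (shifts (arcEdges a) (arcsEdges arcs))))
        set (λ w → trans (parity-count w (v , Sign.-) (v , s) (ends bs) refl q) (par w))
    -- The partner belongs to another arc `b`, and the two merge into one from `y` to `z`.
    ...   | there s∈bs
      with z , b , cs , q″ , es″ ← ∈-ends⇒arc bs s∈bs
      with assembly arcs tours es′ set par ←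
        assemble red ((y , z , join-arc a b) ∷ cs) (↭-sym (drop-∷ (↭-trans q′
          (↭-trans (prep y q″) (↭.swap y (v , s) ↭-refl))))) =
      assembly arcs tours
        (↭-trans es (↭-trans (++⁺ˡ (arcEdges a) es″) (↭-trans
          (↭-trans (↭-sym (++-assoc (arcEdges a) (arcEdges b) _))
            (++⁺ʳ _ (↭-sym (join-arc-edges a b)))) es′)))
        set (λ w → trans (parity-count w (v , Sign.-) (v , s) _ refl
          (↭-trans q (prep _ (↭-trans (prep y q″) (↭.swap y (v , s) ↭-refl))))) (par w))

    -- Splicing closed walks into open ones.

    Strands : List (Vertex G × Vertex G) → Set
    Strands = All (λ (u , w) → Bounded 1ℤ u w)

    strandsEdges : ∀ {es} → Strands es → List (Edge G)
    strandsEdges []       = []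
    strandsEdges (t ∷ ts) = boundedEdges t ++ strandsEdges ts

    Touches : ∀ {es} → Vertex G → Strands es → Set
    Touches x ts = Any (λ (_ , t) → Split (Bounded.walk t) x) (All.toList ts)

    touches-incident : ∀ {es e} (ts : Strands es) → e ∈ strandsEdges ts →
      Incident G x e → Touches x ts
    touches-incident (t ∷ ts) e∈ inc with ∈-++⁻ (boundedEdges t) e∈
    ... | inj₁ e∈t  = here (split-incident (Bounded.walk t) e∈t inc)
    ... | inj₂ e∈ts = there (touches-incident ts e∈ts inc)

    -- A detour of weight at most 0 at a visited vertex keeps both the bound 1 and the endpoints of
    -- the strand.
    insert-tour : ∀ {es} (ts : Strands es) → Touches x ts → (c : Bounded 0ℤ x x) →
      Σ[ ts′ ∈ Strands es ] strandsEdges ts′ ↭ boundedEdges c ++ strandsEdges ts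
    insert-tour (bounded p le ∷ ts) (here (a , b , eq)) (bounded c le′) =
      bounded (a ⁀ c ⁀ b) (subst (ℤ._≤ 1ℤ) (sym weight≡) (ℤ.+-mono-≤ le′ le)) ∷ ts ,
      ↭-trans (++⁺ʳ _ edges↭) (++-assoc (walkEdges G c) (walkEdges G p) _)
      where
      edges↭ : walkEdges G (a ⁀ c ⁀ b) ↭ walkEdges G c ++ walkEdges G p
      edges↭ = begin
        walkEdges G (a ⁀ c ⁀ b)                         ≡⟨ walkEdges-⁀ a (c ⁀ b) ⟩
        walkEdges G a ++ walkEdges G (c ⁀ b)            ≡⟨ cong (walkEdges G a ++_) (walkEdges-⁀ c b) ⟩
        walkEdges G a ++ walkEdges G c ++ walkEdges G b ↭⟨ shifts (walkEdges G a) (walkEdges G c) ⟩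
        walkEdges G c ++ walkEdges G a ++ walkEdges G b ≡⟨ cong (walkEdges G c ++_) eq ⟨
        walkEdges G c ++ walkEdges G p                  ∎
        where open PermutationReasoning
      weight≡ : walkWeight (a ⁀ c ⁀ b) ≡ walkWeight c ℤ.+ walkWeight p
      weight≡ = trans (Σℤ.total-↭ _ edges↭) (Σℤ.total-++ _ (walkEdges G c) _)
    insert-tour (t ∷ ts) (there touch) c with ts′ , p ← insert-tour ts touch c =
      t ∷ ts′ , ↭-trans (++⁺ˡ (boundedEdges t) p) (shifts (boundedEdges t) (boundedEdges c))

    Meets : Vertex G → List Tour → Set
    Meets x = Any (λ (_ , c) → Split (Bounded.walk c) x)

    meets-incident : ∀ {e} cs → e ∈ toursEdges cs → Incident G x e → Meets x cs
    meets-incident (c ∷ cs) e∈ inc with ∈-++⁻ (tourEdges c) e∈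
    ... | inj₁ e∈c  = here (split-incident (Bounded.walk (proj₂ c)) e∈c inc)
    ... | inj₂ e∈cs = there (meets-incident cs e∈cs inc)

    -- A closed walk can be started at any vertex it visits: swapping the two pieces of a split
    -- rotates it to `x`.
    extract-tour : ∀ cs → Meets x cs → Σ[ c ∈ Bounded 0ℤ x x ] ∃[ cs′ ]
      length cs ≡ suc (length cs′) × toursEdges cs ↭ boundedEdges c ++ toursEdges cs′
    extract-tour ((v , bounded p le) ∷ cs) (here (a , b , eq)) =
      bounded (b ⁀ a) (subst (ℤ._≤ 0ℤ) (Σℤ.total-↭ _ edges↭) le) , cs , refl , ++⁺ʳ _ edges↭
      where
      edges↭ : walkEdges G p ↭ walkEdges G (b ⁀ a)
      edges↭ = begin
        walkEdges G p                   ≡⟨ eq ⟩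
        walkEdges G a ++ walkEdges G b  ↭⟨ ++-comm (walkEdges G a) _ ⟩
        walkEdges G b ++ walkEdges G a  ≡⟨ walkEdges-⁀ b a ⟨
        walkEdges G (b ⁀ a)             ∎
        where open PermutationReasoning
    extract-tour (c ∷ cs) (there m) with c′ , cs′ , len , p ← extract-tour cs m =
      c′ , c ∷ cs′ , cong suc len ,
      ↭-trans (++⁺ˡ (tourEdges c) p) (shifts (tourEdges c) (boundedEdges c′))

    module _ (conn : ∀ u v → Walk G u v) where

      -- Along a walk from the open trails to the closed ones, the first edge lying
      -- on a closed trail starts at a common vertex.
      first-meeting : ∀ {es} (ts : Strands es) cs → (∀ e → e ∈ strandsEdges ts ++ toursEdges cs) →
        Walk G u w → Touches u ts → Meets w cs → ∃[ x ] Touches x ts × Meets x cs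
      first-meeting ts cs cover nil          t m = _ , t , m
      first-meeting ts cs cover (cons e j p) t m with ∈-++⁻ (strandsEdges ts) (cover e)
      ... | inj₁ e∈ts = first-meeting ts cs cover p (touches-incident ts e∈ts (Joins⇒Incidentʳ j)) m
      ... | inj₂ e∈cs = _ , t , meets-incident cs e∈cs (Joins⇒Incidentˡ j)

      -- Induction on the number of tours, with connectedness supplying a vertex for each splice.
      -- Indexing `Strands` by endpoint pairs keeps the number of strands fixed.
      absorb : ∀ {es} k (t : Strands es) cs → length cs ≡ k → es ≢ [] →
        strandsEdges t ++ toursEdges cs ↭ allFin size →
        Σ[ ts′ ∈ Strands es ] strandsEdges ts′ ↭ allFin size
      absorb k       ts       []          len ne p = ts , ↭-trans (↭-sym (++-identityʳ _)) p
      absorb k       []       (c ∷ cs)    len ne p = contradiction refl ne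
      absorb (suc k) (t ∷ ts) cs@(c ∷ _) len ne p
        with x , touch , meet ← first-meeting (t ∷ ts) cs (λ e → ∈-resp-↭ (↭-sym p) (∈-allFin e))
               (conn _ _) (here (split-start (Bounded.walk t)))
               (here (split-start (Bounded.walk (proj₂ c))))
        with c′ , cs′ , len′ , q ← extract-tour cs meet
        with ts′ , r ← insert-tour (t ∷ ts) touch c′ =
        absorb k ts′ cs′ (ℕ.suc-injective (trans (sym len′) len)) ne (begin
          strandsEdges ts′ ++ toursEdges cs′
            ↭⟨ ++⁺ʳ _ r ⟩
          (boundedEdges c′ ++ strandsEdges (t ∷ ts)) ++ toursEdges cs′
            ↭⟨ ++⁺ʳ _ (++-comm (boundedEdges c′) _) ⟩
          (strandsEdges (t ∷ ts) ++ boundedEdges c′) ++ toursEdges cs′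
            ↭⟨ ++-assoc (strandsEdges (t ∷ ts)) _ _ ⟩
          strandsEdges (t ∷ ts) ++ boundedEdges c′ ++ toursEdges cs′
            ↭⟨ ++⁺ˡ (strandsEdges (t ∷ ts)) q ⟨
          strandsEdges (t ∷ ts) ++ toursEdges cs
            ↭⟨ p ⟩
          allFin size ∎)
        where open PermutationReasoning

-- Duplicate-free concatenations as partitions.

module _ {a} {A : Set a} where

  Unique-resp-↭ : ∀ {xs ys : List A} → xs ↭ ys → Unique xs → Unique ys
  Unique-resp-↭ p = Permutationₛ.Unique-resp-↭ (≡.setoid A) (↭⇒↭ₛ p)

  Unique-++⁻ : ∀ (xs : List A) {ys} → Unique (xs ++ ys) → Unique xs × Unique ys × Disjoint xs ys
  Unique-++⁻ []       ys!           = [] , ys! , λ ()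
  Unique-++⁻ (x ∷ xs) (x∉ ∷ xsys!) with xs! , ys! , dis ← Unique-++⁻ xs xsys! =
    All.++⁻ˡ xs x∉ ∷ xs! , ys! , λ where
      (here refl  , v∈ys) → All.lookup (All.++⁻ʳ xs x∉) v∈ys refl
      (there v∈xs , v∈ys) → dis (v∈xs , v∈ys)

module _ {A B : Set} (g : A → List B) where

  unique-block : ∀ xs → Unique (concatMap g xs) → ∀ i → Unique (g (lookup xs i))
  unique-block (x ∷ xs) u zero    = proj₁ (Unique-++⁻ (g x) u)
  unique-block (x ∷ xs) u (suc i) = unique-block xs (proj₁ (proj₂ (Unique-++⁻ (g x) u))) i

  ∈-block : ∀ {b} xs → b ∈ concatMap g xs → ∃[ i ] b ∈ g (lookup xs i)
  ∈-block xs b∈ = Any.index any , lookup-index any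
    where any = ∈-concatMap⁻ g {xs = xs} b∈

  block⊆ : ∀ {b} xs i → b ∈ g (lookup xs i) → b ∈ concatMap g xs
  block⊆ (x ∷ xs) zero    b∈ = ∈-++⁺ˡ b∈
  block⊆ (x ∷ xs) (suc i) b∈ = ∈-++⁺ʳ (g x) (block⊆ xs i b∈)

  block-injective : ∀ {b} xs → Unique (concatMap g xs) → ∀ i j →
    b ∈ g (lookup xs i) → b ∈ g (lookup xs j) → i ≡ j
  block-injective (x ∷ xs) u zero    zero    b∈ b∈′ = refl
  block-injective (x ∷ xs) u zero    (suc j) b∈ b∈′ =
    contradiction (b∈ , block⊆ xs j b∈′) (proj₂ (proj₂ (Unique-++⁻ (g x) u)))
  block-injective (x ∷ xs) u (suc i) zero    b∈ b∈′ =
    contradiction (b∈′ , block⊆ xs i b∈) (proj₂ (proj₂ (Unique-++⁻ (g x) u)))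
  block-injective (x ∷ xs) u (suc i) (suc j) b∈ b∈′ =
    cong suc (block-injective xs (proj₁ (proj₂ (Unique-++⁻ (g x) u))) i j b∈ b∈′)

-- Counting ends, and parities of weights.

sum-at : ∀ {n} (u : Fin n) → sumℕ (λ v → Σℕ.at v u 1) ≡ 1
sum-at {suc n} zero    = cong suc (ℕΣ.sum-replicate-zero n)
sum-at {suc n} (suc u) = sum-at u

sum-count : ∀ {n} (L : List (End n)) → sumℕ (λ v → count v L) ≡ length L
sum-count {n} []            = ℕΣ.sum-replicate-zero n
sum-count {n} ((u , s) ∷ L) = trans
  (ℕΣ.∑-distrib-+ (λ v → Σℕ.at v u 1) (λ v → count v L))
  (cong₂ ℕ._+_ (sum-at u) (sum-count L))

length-pairs : ∀ {A B : Set} (g h : A → B) xs →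
  length (concatMap (λ x → g x ∷ h x ∷ []) xs) ≡ 2 ℕ.* length xs
length-pairs g h []       = refl
length-pairs g h (x ∷ xs) =
  trans (cong (2 ℕ.+_) (length-pairs g h xs)) (sym (ℕ.*-distribˡ-+ 2 1 (length xs)))

oddness : ℕ → ℕ
oddness m = if does (odd? m) then 1 else 0

oddness-cong : ∀ l m → parity l ≡ parity m → oddness l ≡ oddness m
oddness-cong _ _ = cong (λ p → if does (p ℙ.≟ 1ℙ) then 1 else 0)

≤1⇒oddness≡ : ∀ {m} → m ℕ.≤ 1 → oddness m ≡ m
≤1⇒oddness≡ z≤n       = refl
≤1⇒oddness≡ (s≤s z≤n) = refl

parity-suc : ∀ m → parity (suc m) ≡ parity m ⁻¹
parity-suc m = trans (sym (ℙ.⁻¹-involutive (parity (suc m)))) (cong _⁻¹ (ℙ.suc-homo-⁻¹ m))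

parity-∣value+∣ : ∀ s i → parity ℤ.∣ value s ℤ.+ i ∣ ≡ parity ℤ.∣ i ∣ ⁻¹
parity-∣value+∣ Sign.+ (+ m)        = parity-suc m
parity-∣value+∣ Sign.+ -[1+ zero ]  = refl
parity-∣value+∣ Sign.+ -[1+ suc m ] = parity-suc m
parity-∣value+∣ Sign.- (+ zero)     = refl
parity-∣value+∣ Sign.- (+ suc m)    = sym (ℙ.suc-homo-⁻¹ m)
parity-∣value+∣ Sign.- -[1+ m ]     = parity-suc (suc m)

-- An even integer that is at most 1 is at most 0. Since weight and length of a strand have the same
-- parity, only strands of odd length can contribute 1.
≤1⇒≤oddness : ∀ i m → parity ℤ.∣ i ∣ ≡ parity m → i ℤ.≤ 1ℤ → i ℤ.≤ + oddness m
≤1⇒≤oddness (+ k)    m par (+≤+ k≤1) =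
  ℤ.≤-reflexive (cong +_ (trans (sym (≤1⇒oddness≡ k≤1)) (oddness-cong k m par)))
≤1⇒≤oddness -[1+ k ] m par le        = -≤+

subset-all : ∀ {n ℓ} {P : Pred (Fin n) ℓ} (P? : Decidable P) → (∀ i → P i) → n ℕ.≤ ∣ subset P? ∣
subset-all {zero}  P? all = z≤n
subset-all {suc n} P? all rewrite dec-true (P? zero) (all zero) =
  s≤s (subset-all (P? ∘ suc) (all ∘ suc))

-- A subset of full cardinality is `⊤`. For k = n this turns the submatching condition into one at
-- every vertex.
all-subset : ∀ {n ℓ} {P : Pred (Fin n) ℓ} (P? : Decidable P) → n ℕ.≤ ∣ subset P? ∣ → ∀ i → P i
all-subset {n} P? n≤ i with P? i in eq
... | yes Pi = Pi
... | no  _  = contradiction false≡true (λ ())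
  where
  open ≡-Reasoning
  false≡true : false ≡ true
  false≡true = begin
    false                     ≡⟨ cong does eq ⟨
    does (P? i)               ≡⟨ lookup∘tabulate (does ∘ P?) i ⟨
    Vec.lookup (subset P?) i
      ≡⟨ cong (λ S → Vec.lookup S i) (∣p∣≡n⇒p≡⊤ {p = subset P?} (ℕ.≤-antisym (∣p∣≤n (subset P?)) n≤)) ⟩
    Vec.lookup ⊤ i            ≡⟨ lookup-replicate i true ⟩
    true                      ∎

-- From a signing to a complete partition.

module _ {n} (G : Graph n) where
  open Graph G

  Satisfied : Signing G → Set
  Satisfied f = ∀ v → weight G f (incidentEdges G v) ℤ.≤ 1ℤ

  degree-halves : ∀ v → degree G v ≡ Σℕ.total (Σℕ.halves G v (λ _ → 1)) (allFin size)
  degree-halves v = trans (∣subset∣ (incident? G v)) (Σℕ.star G v (λ _ → 1))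

  weight-⊤ : ∀ f → weight G f ⊤ ≡ listWeight G f (allFin size)
  weight-⊤ f = trans
    (ℤΣ.sum-cong-≗ (λ e → cong (if_then value (f e) else 0ℤ) (lookup-replicate e true)))
    (sym (Σℤ.total-tabulate (value ∘ f) id))

  weight-incident : ∀ f v →
    weight G f (incidentEdges G v) ≡ Σℤ.total (Σℤ.halves G v (value ∘ f)) (allFin size)
  weight-incident f v = trans
    (ℤΣ.sum-cong-≗ (λ e → cong (if_then value (f e) else 0ℤ)
      (lookup∘tabulate (does ∘ incident? G v) e)))
    (Σℤ.star G v (value ∘ f))

  ∣oddVertices∣ : ∣ oddVertices G ∣ ≡ sumℕ (λ v → oddness (degree G v))
  ∣oddVertices∣ = ∣subset∣ (λ v → odd? (degree G v))

  module _ (f : Signing G) where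

    parity-listWeight : ∀ es → parity ℤ.∣ listWeight G f es ∣ ≡ parity (length es)
    parity-listWeight []       = refl
    parity-listWeight (e ∷ es) = trans (parity-∣value+∣ (f e) (listWeight G f es))
      (trans (cong _⁻¹ (parity-listWeight es)) (sym (parity-suc (length es))))

    edgeArc : ∀ e → Arc G f (src e , f e) (tgt e , f e)
    edgeArc e = arc (cons e (inj₁ (refl , refl)) nil)
      (ℤ.≤-reflexive (cong (λ i → i ℤ.+ i) (ℤ.+-identityʳ (value (f e)))))

    edgeArcs : List (Edge G) → Arcs G f
    edgeArcs = map (λ e → _ , _ , edgeArc e)

    edges-edgeArcs : ∀ es → arcsEdges G f (edgeArcs es) ≡ es
    edges-edgeArcs []       = refl
    edges-edgeArcs (e ∷ es) = cong (e ∷_) (edges-edgeArcs es)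

    count-edgeArcs : ∀ v es →
      count v (ends G f (edgeArcs es)) ≡ Σℕ.total (Σℕ.halves G v (λ _ → 1)) es
    count-edgeArcs v []       = refl
    count-edgeArcs v (e ∷ es) = trans
      (cong (λ m → Σℕ.at v (src e) 1 ℕ.+ (Σℕ.at v (tgt e) 1 ℕ.+ m)) (count-edgeArcs v es))
      (sym (ℕ.+-assoc (Σℕ.at v (src e) 1) _ _))

    charge-edgeArcs : ∀ v es →
      charge v (ends G f (edgeArcs es)) ≡ Σℤ.total (Σℤ.halves G v (value ∘ f)) es
    charge-edgeArcs v []       = refl
    charge-edgeArcs v (e ∷ es) = trans
      (cong (λ i → Σℤ.at v (src e) (value (f e)) ℤ.+ (Σℤ.at v (tgt e) (value (f e)) ℤ.+ i))
        (charge-edgeArcs v es))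
      (sym (ℤ.+-assoc (Σℤ.at v (src e) (value (f e))) _ _))

    -- The initial charge at `v` is f(E(v)), so `Satisfied f` makes the ends of the single edges
    -- admissible.
    decompose : Satisfied f → Assembly G f (edgeArcs (allFin size))
    decompose sat = assemble G f (reduces _ ℕ.≤-refl adm) (edgeArcs (allFin size)) ↭-refl
      where
      adm : Admissible (ends G f (edgeArcs (allFin size)))
      adm v = subst (ℤ._≤ 1ℤ)
        (trans (weight-incident f v) (sym (charge-edgeArcs v (allFin size))))
        (sat v)

    module _ (A : Assembly G f (edgeArcs (allFin size))) where
      open Assembly A

      -- The parity of the count starts as that of the degree and survives gluing; a settled count
      -- is at most 1, hence determined by its parity.
      count≡oddness : ∀ v → count v (ends G f arcs) ≡ oddness (degree G v)
      count≡oddness v = begin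
        count v (ends G f arcs)             ≡⟨ ≤1⇒oddness≡ (isSettled v) ⟨
        oddness (count v (ends G f arcs))   ≡⟨ oddness-cong initial (count v (ends G f arcs)) (parity≡ v) ⟨
        oddness initial
          ≡⟨ cong oddness (trans (count-edgeArcs v (allFin size)) (sym (degree-halves v))) ⟩
        oddness (degree G v)                ∎
        where
        open ≡-Reasoning
        initial = count v (ends G f (edgeArcs (allFin size)))

      2*arcs≡odd : 2 ℕ.* length arcs ≡ ∣ oddVertices G ∣
      2*arcs≡odd = begin
        2 ℕ.* length arcs                       ≡⟨ length-pairs proj₁ (proj₁ ∘ proj₂) arcs ⟨
        length (ends G f arcs)                  ≡⟨ sum-count (ends G f arcs) ⟨
        sumℕ (λ v → count v (ends G f arcs))    ≡⟨ ℕΣ.sum-cong-≗ count≡oddness ⟩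
        sumℕ (λ v → oddness (degree G v))       ≡⟨ ∣oddVertices∣ ⟨
        ∣ oddVertices G ∣                       ∎
        where open ≡-Reasoning

      cover : arcsEdges G f arcs ++ toursEdges G f tours ↭ allFin size
      cover = ↭-trans (↭-sym edges↭) (↭-reflexive (edges-edgeArcs (allFin size)))

    terminals : ∃₂ (Arc G f) → Vertex G × Vertex G
    terminals (x , y , _) = proj₁ x , proj₁ y

    arcs⇒strands : ∀ as → Strands G f (map terminals as)
    arcs⇒strands []               = []
    arcs⇒strands ((_ , _ , a) ∷ as) = arc⇒bounded G f a ∷ arcs⇒strands as

    edges-arcs⇒strands : ∀ as → strandsEdges G f (arcs⇒strands as) ≡ arcsEdges G f as
    edges-arcs⇒strands []       = refl
    edges-arcs⇒strands ((_ , _ , a) ∷ as) = cong (Arc.arcEdges a ++_) (edges-arcs⇒strands as)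

    Strand : Set
    Strand = ∃ (λ ((u , w) : Vertex G × Vertex G) → Bounded G f 1ℤ u w)

    strandEdges : Strand → List (Edge G)
    strandEdges (_ , t) = Bounded.boundedEdges t

    concat-strands : ∀ {es} (ts : Strands G f es) →
      strandsEdges G f ts ≡ concatMap strandEdges (All.toList ts)
    concat-strands []       = refl
    concat-strands (t ∷ ts) = cong (Bounded.boundedEdges t ++_) (concat-strands ts)

    length-strands : ∀ {es} (ts : Strands G f es) → length (All.toList ts) ≡ length es
    length-strands []       = refl
    length-strands (t ∷ ts) = cong suc (length-strands ts)

    weight≤oddness : ∀ ss →
      listWeight G f (concatMap strandEdges ss) ℤ.≤ + Σℕ.total (oddness ∘ length ∘ strandEdges) ss
    weight≤oddness []       = ℤ.≤-refl
    weight≤oddness (s@(_ , bounded p le) ∷ ss) = begin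
      listWeight G f (strandEdges s ++ concatMap strandEdges ss)
        ≡⟨ Σℤ.total-++ (value ∘ f) (strandEdges s) _ ⟩
      walkWeight G f p ℤ.+ listWeight G f (concatMap strandEdges ss)
        ≤⟨ ℤ.+-mono-≤ (≤1⇒≤oddness (walkWeight G f p) (length (strandEdges s))
                                      (parity-listWeight (strandEdges s)) le)
             (weight≤oddness ss) ⟩
      + oddness (length (strandEdges s)) ℤ.+ + Σℕ.total (oddness ∘ length ∘ strandEdges) ss
        ≡⟨ ℤ.pos-+ (oddness (length (strandEdges s))) _ ⟨
      + Σℕ.total (oddness ∘ length ∘ strandEdges) (s ∷ ss) ∎
      where open ℤ.≤-Reasoning

    module _ (ss : List Strand) (ss↭ : concatMap strandEdges ss ↭ allFin size)
             (2*ss≡odd : 2 ℕ.* length ss ≡ ∣ oddVertices G ∣) where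

      private
        -- This one fact makes every strand a trail and any two strands edge-disjoint.
        ss! : Unique (concatMap strandEdges ss)
        ss! = Unique-resp-↭ (↭-sym ss↭) (Unique.allFin⁺ size)

      strandPartition : CompletePartition G
      strandPartition = record
        { k         = length ss
        ; 2k-odd    = 2*ss≡odd
        ; trails    = λ i → record
          { walk    = Bounded.walk (proj₂ (lookup ss i))
          ; isTrail = unique-block strandEdges ss ss! i
          }
        ; partition = λ e →
            let i , e∈i = ∈-block strandEdges ss (∈-resp-↭ (↭-sym ss↭) (∈-allFin e))
            in i , e∈i , λ {j} → block-injective strandEdges ss ss! i j e∈i
        }

      weight≤τ : weight G f ⊤ ℤ.≤ + CompletePartition.τ strandPartition
      weight≤τ = begin
        weight G f ⊤                                      ≡⟨ weight-⊤ f ⟩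
        listWeight G f (allFin size)                      ≡⟨ Σℤ.total-↭ _ ss↭ ⟨
        listWeight G f (concatMap strandEdges ss)         ≤⟨ weight≤oddness ss ⟩
        + Σℕ.total (oddness ∘ length ∘ strandEdges) ss
          ≡⟨ cong +_ (Σℕ.total-lookup (oddness ∘ length ∘ strandEdges) ss) ⟨
        + sumℕ (oddness ∘ length ∘ strandEdges ∘ lookup ss)
          ≡⟨ cong +_ (∣subset∣ (λ i → odd? (length (strandEdges (lookup ss i))))) ⟨
        + CompletePartition.τ strandPartition             ∎
        where open ℤ.≤-Reasoning

    partition-from-signing : Connected G → ¬ Eulerian G → Satisfied f →
      ∃[ P ] weight G f ⊤ ℤ.≤ + CompletePartition.τ {G = G} P
    partition-from-signing (v₀ , conn) ¬eul sat with decompose sat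
    -- Without arcs there is nothing to splice into, so an empty walk at `v₀` serves as the only
    -- strand; it grows into an Eulerian trail.
    ... | A@(assembly [] tours _ _ _)
      with (t ∷ []) , p ← absorb G f conn _ (bounded {u = v₀} nil (+≤+ z≤n) ∷ []) tours
                            refl (λ ()) (cover A) =
      contradiction (v₀ , Bounded.walk t ,
        Unique-resp-↭ (↭-sym t↭) (Unique.allFin⁺ size) ,
        λ e → ∈-resp-↭ (↭-sym t↭) (∈-allFin e)) ¬eul
      where t↭ = ↭-trans (↭-sym (++-identityʳ _)) p
    ... | A@(assembly arcs@(_ ∷ _) tours _ _ _)
      with ts , p ← absorb G f conn _ (arcs⇒strands arcs) tours refl (λ ())
             (↭-trans (↭-reflexive (cong (_++ toursEdges G f tours) (edges-arcs⇒strands arcs)))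
               (cover A)) =
      strandPartition ss ss↭ 2*ss , weight≤τ ss ss↭ 2*ss
      where
      ss = All.toList ts
      ss↭ = ↭-trans (↭-reflexive (sym (concat-strands ts))) p
      2*ss : 2 ℕ.* length ss ≡ ∣ oddVertices G ∣
      2*ss = trans (cong (2 ℕ.*_) (trans (length-strands ts) (length-map terminals arcs))) (2*arcs≡odd A)

-- Comparing sums and their parities.

sumℤ-mono : ∀ {n} {g h : Fin n → ℤ} → (∀ i → g i ℤ.≤ h i) → sumℤ g ℤ.≤ sumℤ h
sumℤ-mono {zero}  le = ℤ.≤-refl
sumℤ-mono {suc n} le = ℤ.+-mono-≤ (le zero) (sumℤ-mono (le ∘ suc))

sumℕ-mono : ∀ {n} {g h : Fin n → ℕ} → (∀ i → g i ℕ.≤ h i) → sumℕ g ℕ.≤ sumℕ h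
sumℕ-mono {zero}  le = ℕ.≤-refl
sumℕ-mono {suc n} le = ℕ.+-mono-≤ (le zero) (sumℕ-mono (le ∘ suc))

sumℤ-pos : ∀ {n} (g : Fin n → ℕ) → sumℤ (λ i → + g i) ≡ + sumℕ g
sumℤ-pos {zero}  g = refl
sumℤ-pos {suc n} g = trans (cong (ℤ._+_ (+ g zero)) (sumℤ-pos (g ∘ suc))) (sym (ℤ.pos-+ (g zero) _))

-- A strict inequality `g i < h i` at any index would make the total of `h` exceed that of `g`.
sumℕ-squeeze : ∀ {n} {g h : Fin n → ℕ} → (∀ i → g i ℕ.≤ h i) → sumℕ h ℕ.≤ sumℕ g → ∀ i → h i ℕ.≤ g i
sumℕ-squeeze {suc n} {g} {h} le tot zero = ℕ.+-cancelʳ-≤ (sumℕ (h ∘ suc)) (h zero) (g zero)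
  (ℕ.≤-trans tot (ℕ.+-monoʳ-≤ (g zero) (sumℕ-mono (le ∘ suc))))
sumℕ-squeeze {suc n} {g} {h} le tot (suc i) = sumℕ-squeeze (le ∘ suc)
  (ℕ.+-cancelˡ-≤ (h zero) _ _ (ℕ.≤-trans tot (ℕ.+-monoˡ-≤ _ (le zero)))) i

parity-sum : ∀ {n} (g h : Fin n → ℕ) → (∀ i → parity (g i) ≡ parity (h i)) →
  parity (sumℕ g) ≡ parity (sumℕ h)
parity-sum {zero}  g h eq = refl
parity-sum {suc n} g h eq = trans (ℙ.+-homo-+ (g zero) (sumℕ (g ∘ suc))) (trans
  (cong₂ ℙ._+_ (eq zero) (parity-sum (g ∘ suc) (h ∘ suc) (eq ∘ suc)))
  (sym (ℙ.+-homo-+ (h zero) (sumℕ (h ∘ suc)))))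

-- One step along a walk: the vertex reached contributes `b` to the edge just used and again to the
-- rest, and `b + b` is even.
parity-telescope : ∀ a b c r → parity r ≡ parity (b ℕ.+ c) →
  parity ((a ℕ.+ b) ℕ.+ r) ≡ parity (a ℕ.+ c)
parity-telescope a b c r eq = begin
  parity ((a ℕ.+ b) ℕ.+ r)      ≡⟨ ℙ.+-homo-+ (a ℕ.+ b) r ⟩
  parity (a ℕ.+ b) ℙ.+ parity r ≡⟨ cong₂ ℙ._+_ (ℙ.+-homo-+ a b) (trans eq (ℙ.+-homo-+ b c)) ⟩
  (p ℙ.+ q) ℙ.+ (q ℙ.+ t)       ≡⟨ ℙ.+-assoc p q (q ℙ.+ t) ⟩
  p ℙ.+ (q ℙ.+ (q ℙ.+ t))       ≡⟨ cong (p ℙ.+_) (ℙ.+-assoc q q t) ⟨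
  p ℙ.+ ((q ℙ.+ q) ℙ.+ t)       ≡⟨ cong (λ x → p ℙ.+ (x ℙ.+ t)) (ℙ.p+p≡0ℙ q) ⟩
  p ℙ.+ t                       ≡⟨ ℙ.+-homo-+ a c ⟨
  parity (a ℕ.+ c)              ∎
  where
  open ≡-Reasoning
  p = parity a
  q = parity b
  t = parity c

oddness≤ : ∀ m → oddness m ℕ.≤ m
oddness≤ zero    = z≤n
oddness≤ (suc m) with does (odd? (suc m))
... | true  = s≤s z≤n
... | false = z≤n

oddness≤1 : ∀ m → oddness m ℕ.≤ 1
oddness≤1 m with does (odd? m)
... | true  = s≤s z≤n
... | false = z≤n

-- Alternating signs along a list.

module _ {A : Set} where

  -- The position is read off the membership proof, which is what a partition supplies for each
  -- edge.
  signAt : ∀ {x : A} {xs} → Sign → x ∈ xs → Sign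
  signAt s (here _)  = s
  signAt s (there m) = signAt (Sign.opposite s) m

  data Alternates (f : A → Sign) : Sign → List A → Set where
    []  : ∀ {s} → Alternates f s []
    _∷_ : ∀ {s x xs} → f x ≡ s → Alternates f (Sign.opposite s) xs → Alternates f s (x ∷ xs)

  alternates : ∀ {f : A → Sign} s xs → (∀ {x} (m : x ∈ xs) → f x ≡ signAt s m) → Alternates f s xs
  alternates s []       eq = []
  alternates s (x ∷ xs) eq = eq (here refl) ∷ alternates (Sign.opposite s) xs (eq ∘ there)

value-opposite : ∀ s → value s ℤ.+ value (Sign.opposite s) ≡ 0ℤ
value-opposite Sign.+ = refl
value-opposite Sign.- = refl

-- From a complete partition to a signing.

module _ {n} (G : Graph n) where
  open Graph G

  module _ (f : Signing G) where

    -- Neighbouring signs cancel in pairs, leaving one copy of `s` when the length is odd.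
    alternating-weight : ∀ {s es} → Alternates f s es →
      listWeight G f es ≡ (if does (odd? (length es)) then value s else 0ℤ)
    alternating-weight []                         = refl
    alternating-weight {s} {e ∷ es} (refl ∷ alt)
      rewrite alternating-weight alt | parity-suc (length es) with parity (length es)
    ... | 0ℙ = ℤ.+-identityʳ _
    ... | 1ℙ = value-opposite (f e)

    -- At an inner visit the two edges have opposite signs and cancel. The first end has sign `s`;
    -- the last, whose sign depends on the length, is bounded by 1.
    alternating-charge : ∀ v {s u w} (p : Walk G u w) → Alternates f s (walkEdges G p) →
      Σℤ.total (Σℤ.halves G v (value ∘ f)) (walkEdges G p) ℤ.≤ Σℤ.at v u (value s) ℤ.+ Σℤ.at v w 1ℤ
    -- The empty walk contributes 0, which is at most `value s + 1`.
    alternating-charge v {s} {u} nil [] with does (u ≟ v) | s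
    ... | true  | Sign.+ = +≤+ z≤n
    ... | true  | Sign.- = ℤ.≤-refl
    ... | false | _      = ℤ.≤-refl
    alternating-charge v {s} {u} {w} (cons {v = x} e j p) (refl ∷ alt) = begin
      Σℤ.halves G v (value ∘ f) e ℤ.+ rest
        ≡⟨ cong (ℤ._+ rest) (Σℤ.halves-joins G v (value ∘ f) j) ⟩
      (at-u ℤ.+ at-x) ℤ.+ rest
        ≤⟨ ℤ.+-monoʳ-≤ (at-u ℤ.+ at-x) (alternating-charge v p alt) ⟩
      (at-u ℤ.+ at-x) ℤ.+ (at-x⁻ ℤ.+ at-w)
        ≡⟨ ℤ.+-assoc at-u at-x (at-x⁻ ℤ.+ at-w) ⟩
      at-u ℤ.+ (at-x ℤ.+ (at-x⁻ ℤ.+ at-w))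
        ≡⟨ cong (ℤ._+_ at-u) (ℤ.+-assoc at-x at-x⁻ at-w) ⟨
      at-u ℤ.+ ((at-x ℤ.+ at-x⁻) ℤ.+ at-w)
        ≡⟨ cong (λ i → at-u ℤ.+ (i ℤ.+ at-w)) at-opposite ⟩
      at-u ℤ.+ (0ℤ ℤ.+ at-w)
        ≡⟨ cong (ℤ._+_ at-u) (ℤ.+-identityˡ at-w) ⟩
      at-u ℤ.+ at-w ∎
      where
      open ℤ.≤-Reasoning
      rest  = Σℤ.total (Σℤ.halves G v (value ∘ f)) (walkEdges G p)
      at-u  = Σℤ.at v u (value s)
      at-x  = Σℤ.at v x (value s)
      at-x⁻ = Σℤ.at v x (value (Sign.opposite s))
      at-w  = Σℤ.at v w 1ℤ
      at-opposite : at-x ℤ.+ at-x⁻ ≡ 0ℤ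
      at-opposite with does (x ≟ v)
      ... | true  = value-opposite s
      ... | false = refl

  -- Every inner visit uses two edge ends, so modulo 2 only the ends of the walk remain.
  walk-degree : ∀ v {u w} (p : Walk G u w) →
    parity (Σℕ.total (Σℕ.halves G v (λ _ → 1)) (walkEdges G p))
      ≡ parity (Σℕ.at v u 1 ℕ.+ Σℕ.at v w 1)
  walk-degree v {u} nil with does (u ≟ v)
  ... | true  = refl
  ... | false = refl
  walk-degree v {u} {w} (cons {v = x} e j p) = trans
    (cong (λ m → parity (m ℕ.+ Σℕ.total (Σℕ.halves G v (λ _ → 1)) (walkEdges G p)))
      (Σℕ.halves-joins G v (λ _ → 1) j))
    (parity-telescope (Σℕ.at v u 1) (Σℕ.at v x 1) (Σℕ.at v w 1) _ (walk-degree v p))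

  module _ (P : CompletePartition G) where
    open CompletePartition P
    open Trail renaming (start to source; end to target)

    -- Duplicate-free lists with the same elements are permutations of each other. This lets sums
    -- over all edges be taken trail by trail.
    trails↭ : concatMap edges (tabulate trails) ↭ allFin size
    trails↭ = ↭-trans (↭-reflexive (cong concat (map-tabulate trails edges)))
      (∼bag⇒↭ (unique∧set⇒bag
        (Unique.concat⁺ (All.tabulate⁺ (isTrail ∘ trails)) (AllPairs.tabulate⁺ disjoint))
        (Unique.allFin⁺ size)
        (λ {e} → mk⇔ (λ _ → ∈-allFin e) (λ _ → let i , e∈i , _ = partition e in
          ∈-concat⁺′ e∈i (∈-tabulate⁺ i)))))
      where
      disjoint : ∀ {i j} → i ≢ j → Disjoint (edges (trails i)) (edges (trails j))
      disjoint i≢j {e} (e∈i , e∈j) with _ , _ , uniq ← partition e =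
        i≢j (trans (sym (uniq e∈i)) (uniq e∈j))

    total-trailsℕ : ∀ (g : Edge G → ℕ) →
      Σℕ.total g (allFin size) ≡ sumℕ (Σℕ.total g ∘ edges ∘ trails)
    total-trailsℕ g = trans (Σℕ.total-↭ g (↭-sym trails↭))
      (trans (Σℕ.total-concatMap g edges (tabulate trails))
        (Σℕ.total-tabulate (Σℕ.total g ∘ edges) trails))

    total-trailsℤ : ∀ (g : Edge G → ℤ) →
      Σℤ.total g (allFin size) ≡ sumℤ (Σℤ.total g ∘ edges ∘ trails)
    total-trailsℤ g = trans (Σℤ.total-↭ g (↭-sym trails↭))
      (trans (Σℤ.total-concatMap g edges (tabulate trails))
        (Σℤ.total-tabulate (Σℤ.total g ∘ edges) trails))

    endCount : Vertex G → Fin k → ℕ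
    endCount v i = Σℕ.at v (source (trails i)) 1 ℕ.+ Σℕ.at v (target (trails i)) 1

    parity-degree : ∀ v → parity (degree G v) ≡ parity (sumℕ (endCount v))
    parity-degree v = trans
      (cong parity (trans (degree-halves G v) (total-trailsℕ (Σℕ.halves G v (λ _ → 1)))))
      (parity-sum _ (endCount v) (λ i → walk-degree v (walk (trails i))))

    sum-endCount : sumℕ (λ v → sumℕ (endCount v)) ≡ 2 ℕ.* k
    sum-endCount = begin
      sumℕ (λ v → sumℕ (endCount v))        ≡⟨ ℕΣ.∑-comm endCount ⟩
      sumℕ (λ i → sumℕ (λ v → endCount v i))
        ≡⟨ ℕΣ.sum-cong-≗ (λ i → trans
             (ℕΣ.∑-distrib-+ (λ v → Σℕ.at v (source (trails i)) 1)
                             (λ v → Σℕ.at v (target (trails i)) 1))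
             (cong₂ ℕ._+_ (sum-at (source (trails i))) (sum-at (target (trails i))))) ⟩
      sumℕ {k} (λ _ → 2)                    ≡⟨ sum-2 k ⟩
      2 ℕ.* k                               ∎
      where
      open ≡-Reasoning
      sum-2 : ∀ m → sumℕ {m} (λ _ → 2) ≡ 2 ℕ.* m
      sum-2 zero    = refl
      sum-2 (suc m) = trans (cong (2 ℕ.+_) (sum-2 m)) (sym (ℕ.*-distribˡ-+ 2 1 m))

    -- By parity every odd vertex is a trail end at least once. The 2k odd vertices thus use up all
    -- 2k ends, and no vertex has one to spare.
    endCount≤1 : ∀ v → sumℕ (endCount v) ℕ.≤ 1
    endCount≤1 v = ℕ.≤-trans
      (sumℕ-squeeze {g = λ v → oddness (degree G v)} {h = λ v → sumℕ (endCount v)}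
        (λ v → ℕ.≤-trans
          (ℕ.≤-reflexive (oddness-cong (degree G v) (sumℕ (endCount v)) (parity-degree v)))
          (oddness≤ (sumℕ (endCount v))))
        (ℕ.≤-reflexive (trans sum-endCount (trans 2k-odd (∣oddVertices∣ G)))) v)
      (oddness≤1 (degree G v))

    alternatingSigning : Signing G
    alternatingSigning e = let _ , e∈i , _ = partition e in signAt Sign.+ e∈i

    signing-alternates : ∀ i → Alternates alternatingSigning Sign.+ (edges (trails i))
    signing-alternates i = alternates Sign.+ (edges (trails i)) eq
      where
      eq : ∀ {e} (m : e ∈ edges (trails i)) → alternatingSigning e ≡ signAt Sign.+ m
      -- The partition's own membership proof fixed the sign of `e`. By `uniq` it concerns the same
      -- trail as `m`, and a duplicate-free list admits only one such proof.
      eq {e} m with j , e∈j , uniq ← partition e with refl ← uniq m =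
        cong (signAt Sign.+) (unique⇒irrelevant (isTrail (trails i)) e∈j m)

    -- Summed over the trails, f(E(v)) is at most the number of trail ends at `v`.
    alternating-satisfied : Satisfied G alternatingSigning
    alternating-satisfied v = begin
      weight G alternatingSigning (incidentEdges G v)
        ≡⟨ weight-incident G alternatingSigning v ⟩
      Σℤ.total (Σℤ.halves G v (value ∘ alternatingSigning)) (allFin size)
        ≡⟨ total-trailsℤ _ ⟩
      sumℤ (Σℤ.total (Σℤ.halves G v (value ∘ alternatingSigning)) ∘ edges ∘ trails)
        ≤⟨ sumℤ-mono (λ i → alternating-charge alternatingSigning v (walk (trails i))
                            (signing-alternates i)) ⟩
      sumℤ (λ i → Σℤ.at v (source (trails i)) 1ℤ ℤ.+ Σℤ.at v (target (trails i)) 1ℤ)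
        ≡⟨ ℤΣ.sum-cong-≗ (λ i → at-pos (source (trails i)) (target (trails i))) ⟩
      sumℤ (λ i → + endCount v i)
        ≡⟨ sumℤ-pos (endCount v) ⟩
      + sumℕ (endCount v)
        ≤⟨ +≤+ (endCount≤1 v) ⟩
      1ℤ ∎
      where
      open ℤ.≤-Reasoning
      at-pos : ∀ u w → Σℤ.at v u 1ℤ ℤ.+ Σℤ.at v w 1ℤ ≡ + (Σℕ.at v u 1 ℕ.+ Σℕ.at v w 1)
      at-pos u w with does (u ≟ v) | does (w ≟ v)
      ... | true  | true  = refl
      ... | true  | false = refl
      ... | false | true  = refl
      ... | false | false = refl

    alternating-total : weight G alternatingSigning ⊤ ≡ + τ
    alternating-total = begin
      weight G alternatingSigning ⊤
        ≡⟨ weight-⊤ G alternatingSigning ⟩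
      listWeight G alternatingSigning (allFin size)
        ≡⟨ total-trailsℤ _ ⟩
      sumℤ (listWeight G alternatingSigning ∘ edges ∘ trails)
        ≡⟨ ℤΣ.sum-cong-≗ (λ i → trans
             (alternating-weight alternatingSigning (signing-alternates i))
             (pos-if (does (odd? (length (edges (trails i))))))) ⟩
      sumℤ (λ i → + oddness (length (edges (trails i))))
        ≡⟨ sumℤ-pos (oddness ∘ length ∘ edges ∘ trails) ⟩
      + sumℕ (λ i → oddness (length (edges (trails i))))
        ≡⟨ cong +_ (∣subset∣ (λ i → odd? (length (edges (trails i))))) ⟨
      + τ ∎
      where
      open ≡-Reasoning
      pos-if : ∀ b → (if b then 1ℤ else 0ℤ) ≡ + (if b then 1 else 0)
      pos-if true  = refl
      pos-if false = refl

-- Existence of a maximum signing.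

allSigns : ∀ m → List (Vec Sign m)
allSigns zero    = Vec.[] ∷ []
allSigns (suc m) = cartesianProductWith Vec._∷_ (Sign.+ ∷ Sign.- ∷ []) (allSigns m)

∈-allSigns : ∀ {m} (ss : Vec Sign m) → ss ∈ allSigns m
∈-allSigns Vec.[]       = here refl
∈-allSigns (s Vec.∷ ss) = ∈-cartesianProductWith⁺ Vec._∷_ (∈-signs s) (∈-allSigns ss)
  where
  ∈-signs : ∀ s → s ∈ Sign.+ ∷ Sign.- ∷ []
  ∈-signs Sign.+ = here refl
  ∈-signs Sign.- = there (here refl)

module _ {n} (G : Graph n) where
  open Graph G

  weight-cong : ∀ {f g : Signing G} → (∀ e → f e ≡ g e) → ∀ S → weight G f S ≡ weight G g S
  weight-cong eq S =
    ℤΣ.sum-cong-≗ (λ e → cong (λ s → if Vec.lookup S e then value s else 0ℤ) (eq e))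

  constant-minus-satisfied : Satisfied G (λ _ → Sign.-)
  constant-minus-satisfied v = begin
    weight G (λ _ → Sign.-) (incidentEdges G v)
      ≤⟨ sumℤ-mono {h = λ _ → 0ℤ} (λ e → ≤0 (Vec.lookup (incidentEdges G v) e)) ⟩
    sumℤ {size} (λ _ → 0ℤ) ≡⟨ ℤΣ.sum-replicate-zero size ⟩
    0ℤ                     ≤⟨ +≤+ z≤n ⟩
    1ℤ                     ∎
    where
    open ℤ.≤-Reasoning
    ≤0 : ∀ b → (if b then -1ℤ else 0ℤ) ℤ.≤ 0ℤ
    ≤0 true  = -≤+
    ≤0 false = ℤ.≤-refl

  -- Signings pass through sign vectors, of which there is a finite list to search. The all-minus
  -- signing is satisfied and serves as the default of `argmax`.
  maximum-signing : ∃[ f ] Satisfied G f × (∀ g → Satisfied G g → weight G g ⊤ ℤ.≤ weight G f ⊤)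
  maximum-signing = Vec.lookup best ,
    argmax-all W minus-satisfied (All.all-filter Satisfied? (allSigns size)) ,
    λ g sat → let g-vec = Vec.tabulate g; g≗ = λ e → sym (lookup∘tabulate g e) in
      subst (ℤ._≤ W best) (sym (weight-cong g≗ ⊤))
        (All.lookup (f[xs]≤f[argmax] {f = W} minus (filter Satisfied? (allSigns size)))
          (∈-filter⁺ Satisfied? (∈-allSigns g-vec)
            (λ v → subst (ℤ._≤ 1ℤ) (weight-cong g≗ (incidentEdges G v)) (sat v))))
    where
    W : Vec Sign size → ℤ
    W ss = weight G (Vec.lookup ss) ⊤
    Satisfied? : Decidable (Satisfied G ∘ Vec.lookup)
    Satisfied? ss = Fin.all? (λ v → weight G (Vec.lookup ss) (incidentEdges G v) ℤ.≤? 1ℤ)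
    minus : Vec Sign size
    minus = Vec.replicate size Sign.-
    minus-satisfied : Satisfied G (Vec.lookup minus)
    minus-satisfied v = subst (ℤ._≤ 1ℤ)
      (weight-cong (λ e → sym (lookup-replicate e Sign.-)) (incidentEdges G v))
      (constant-minus-satisfied v)
    best : Vec Sign size
    best = argmax W minus (filter Satisfied? (allSigns size))

  satisfied⇒submatching : ∀ f → Satisfied G f → SignedSubmatching G n
  satisfied⇒submatching f sat = record
    { signing   = f
    ; satisfied = subset-all (λ v → weight G f (incidentEdges G v) ℤ.≤? 1ℤ) sat
    }

  submatching⇒satisfied : ∀ (s : SignedSubmatching G n) → Satisfied G (SignedSubmatching.signing s)
  submatching⇒satisfied s =
    all-subset (λ v → weight G signing (incidentEdges G v) ℤ.≤? 1ℤ) satisfied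
    where open SignedSubmatching s

theorem3 : ∀ (n : ℕ) (G : Graph n) → Connected G → ¬ Eulerian G →
    ∃[ b ] ∃[ h ] (IsSignedSubmatchingNumber G n b × IsEta G h × b ≡ + h)
theorem3 n G conn ¬eul
  with f , sat , best ← maximum-signing G
  with P , f≤τ ← partition-from-signing G f conn ¬eul sat =
  -- For every `Q`, `τ Q` is at most the weight of `f`, which is at most `τ P`. So `P` is optimal,
  -- and `Q = P` gives equality.
  weight G f ⊤ , τ P ,
  ((satisfied⇒submatching G f sat , refl) , λ s → best (signing s) (submatching⇒satisfied G s)) ,
  ((P , refl) , λ Q → ℤ.drop‿+≤+ (ℤ.≤-trans (τ≤ Q) f≤τ)) ,
  ℤ.≤-antisym f≤τ (τ≤ P)
  where
  open CompletePartition using (τ)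
  open SignedSubmatching using (signing)
  τ≤ : ∀ Q → + τ Q ℤ.≤ weight G f ⊤
  τ≤ Q = ℤ.≤-trans (ℤ.≤-reflexive (sym (alternating-total G Q)))
    (best (alternatingSigning G Q) (alternating-satisfied G Q))
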